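{- For every message $M$ and formula $\phi$: $\vdash[M][M]\phi\leftrightarrow[M]\phi$.
   Context: Fix a finite set $\mathcal{A}$ of agent names containing a distinguished name $\mathsf{CM}$. Messages: $M ::= a \mid B \mid (M,M)$ ($a\in\mathcal{A}$, $B$ optional data constants, pairs). $\mathcal{P}$ is a denumerable set of propositional variables containing atoms $\mathsf{k}_a(M)$ ("$a$ knows $M$"). Formulas: $\phi ::= P \mid \phi\wedge\phi \mid \phi\vee\phi \mid \neg\phi \mid \phi\to\phi \mid [M]\phi$. Abbreviations: $\mathrm{true}:=\mathsf{k}_{\mathsf{CM}}(\mathsf{CM})$, $\mathrm{false}:=\neg\mathrm{true}$, $\phi\leftrightarrow\psi:=(\phi\to\psi)\wedge(\psi\to\phi)$, $\langle M\rangle\phi:=\neg\neg(\mathsf{k}_{\mathsf{CM}}(M)\wedge\phi)$. LIiP is the smallest set of formulas containing all instances of: the axioms of an adequate Hilbert axiomatization of intuitionistic propositional logic; $\mathsf{k}_a(a)$; $(\mathsf{k}_a(M)\wedge\mathsf{k}_a(M'))\leftrightarrow\mathsf{k}_a((M,M'))$; $[M]\mathsf{k}_{\mathsf{CM}}(M)$; $[M](\phi\to\psi)\to([M]\phi\to[M]\psi)$; $[M]\phi\to(\mathsf{k}_{\mathsf{CM}}(M)\to\phi)$; $[M]\phi\to\langle M\rangle\phi$; $\phi\to[M]\phi$; and closed under modus ponens and the rule: if $\mathsf{k}_{\mathsf{CM}}(M)\to\mathsf{k}_{\mathsf{CM}}(M')$ is in the set then so is $[M']\phi\to[M]\phi$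 for every $\phi$. Write $\vdash\phi$ for $\phi\in\mathrm{LIiP}$. -}

module Defs where

open import Data.Fin using (Fin)
open import Data.Nat using (ℕ)
open import Data.Product using (∃-syntax; uncurry)
open import Function.Bundles using (_↔_)
open import Function.Definitions using (Injective)
open import Relation.Binary.PropositionalEquality using (_≡_)

-- The set of data constants is arbitrary and possibly empty.
data Message (Agent Datum : Set) : Set where
  agent : Agent → Message Agent Datum
  datum : Datum → Message Agent Datum
  pair  : Message Agent Datum → Message Agent Datum → Message Agent Datum

-- The propositional variables are any denumerable set in which the
-- knowledge atoms k a M occur as pairwise distinct elements; it may or may not
-- have further elements.
record Signature : Set₁ where
  field
    Agent           : Set
    Agent-finite    : ∃[ n ] (Agent ↔ Fin n)
    CM              : Agent
    Datum           : Set
    Var             : Set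
    Var-denumerable : Var ↔ ℕ
    k               : Agent → Message Agent Datum → Var
    k-injective     : Injective _≡_ _≡_ (uncurry k)

  Msg : Set
  Msg = Message Agent Datum

module Logic (S : Signature) where
  open Signature S

  infix  9 [_]_ ⟨_⟩_ ¬_
  infixr 7 _∧_
  infixr 6 _∨_
  infixr 5 _⇒_
  infix  4 _⇔_
  infix  3 ⊢_

  data Formula : Set where
    var  : Var → Formula
    _∧_  : Formula → Formula → Formula
    _∨_  : Formula → Formula → Formula
    ¬_   : Formula → Formula
    _⇒_  : Formula → Formula → Formula
    [_]_ : Msg → Formula → Formula

  _knows_ : Agent → Msg → Formula
  a knows M = var (k a M)

  _⇔_ : Formula → Formula → Formula
  φ ⇔ ψ = (φ ⇒ ψ) ∧ (ψ ⇒ φ)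

  ⟨_⟩_ : Msg → Formula → Formula
  ⟨ M ⟩ φ = ¬ (¬ ((CM knows M) ∧ φ))

  -- Heyting-style axioms with primitive negation; modus ponens is the only
  -- propositional rule.
  data IPCAxiom : Formula → Set where
    ⇒-K     : ∀ φ ψ   → IPCAxiom (φ ⇒ (ψ ⇒ φ))
    ⇒-S     : ∀ φ ψ χ → IPCAxiom ((φ ⇒ (ψ ⇒ χ)) ⇒ ((φ ⇒ ψ) ⇒ (φ ⇒ χ)))
    ∧-elimˡ : ∀ φ ψ   → IPCAxiom ((φ ∧ ψ) ⇒ φ)
    ∧-elimʳ : ∀ φ ψ   → IPCAxiom ((φ ∧ ψ) ⇒ ψ)
    ∧-intro : ∀ φ ψ   → IPCAxiom (φ ⇒ (ψ ⇒ (φ ∧ ψ)))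
    ∨-introˡ : ∀ φ ψ  → IPCAxiom (φ ⇒ (φ ∨ ψ))
    ∨-introʳ : ∀ φ ψ  → IPCAxiom (ψ ⇒ (φ ∨ ψ))
    ∨-elim  : ∀ φ ψ χ → IPCAxiom ((φ ⇒ χ) ⇒ ((ψ ⇒ χ) ⇒ ((φ ∨ ψ) ⇒ χ)))
    ¬-intro : ∀ φ ψ   → IPCAxiom ((φ ⇒ ψ) ⇒ ((φ ⇒ (¬ ψ)) ⇒ (¬ φ)))
    ¬-elim  : ∀ φ ψ   → IPCAxiom ((¬ φ) ⇒ (φ ⇒ ψ))

  -- ⊢ φ is membership of φ in LIiP, the smallest set closed under the clauses.
  data ⊢_ : Formula → Set where
    ipc             : ∀ {φ} → IPCAxiom φ → ⊢ φ
    own-name        : ∀ a → ⊢ (a knows agent a)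
    knows-pair      : ∀ a M M′ →
                      ⊢ (((a knows M) ∧ (a knows M′)) ⇔ (a knows pair M M′))
    self-knowledge  : ∀ M → ⊢ ([ M ] (CM knows M))
    box-K           : ∀ M φ ψ → ⊢ ([ M ] (φ ⇒ ψ) ⇒ ([ M ] φ ⇒ [ M ] ψ))
    epistemic-truth : ∀ M φ → ⊢ ([ M ] φ ⇒ ((CM knows M) ⇒ φ))
    box⇒diamond     : ∀ M φ → ⊢ ([ M ] φ ⇒ ⟨ M ⟩ φ)
    truth⇒box       : ∀ M φ → ⊢ (φ ⇒ [ M ] φ)
    modus-ponens    : ∀ {φ ψ} → ⊢ (φ ⇒ ψ) → ⊢ φ → ⊢ ψ
    antitonicity    : ∀ {M M′} → ⊢ ((CM knows M) ⇒ (CM knows M′)) →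
                      ∀ φ → ⊢ ([ M′ ] φ ⇒ [ M ] φ)

{-# OPTIONS --safe #-}
module Submission where

open import Defs

-- Epistemic truth turns `[ M ] φ` into `φ` once `CM` knows `M`, and under an outer `[ M ]` that
-- knowledge is free by `self-knowledge`. Hence the outer box absorbs the inner one, via
-- `box-mono-knowing`; the converse is an instance of `truth⇒box`.

module LogicProperties (S : Signature) where
  open Signature S
  open Logic S

  ⇒-trans : ∀ {φ ψ χ} → ⊢ (φ ⇒ ψ) → ⊢ (ψ ⇒ χ) → ⊢ (φ ⇒ χ)
  ⇒-trans p q =
    modus-ponens (modus-ponens (ipc (⇒-S _ _ _)) (modus-ponens (ipc (⇒-K _ _)) q)) p

  ⇒-apply : ∀ {φ ψ χ} → ⊢ (φ ⇒ (ψ ⇒ χ)) → ⊢ ψ → ⊢ (φ ⇒ χ)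
  ⇒-apply p q =
    modus-ponens (modus-ponens (ipc (⇒-S _ _ _)) p) (modus-ponens (ipc (⇒-K _ _)) q)

  ⇔-intro : ∀ {φ ψ} → ⊢ (φ ⇒ ψ) → ⊢ (ψ ⇒ φ) → ⊢ (φ ⇔ ψ)
  ⇔-intro p q = modus-ponens (modus-ponens (ipc (∧-intro _ _)) p) q

  -- Necessitation is derived here: `truth⇒box` boxes the theorem, then `box-K` distributes.
  box-mono : ∀ M {φ ψ} → ⊢ (φ ⇒ ψ) → ⊢ ([ M ] φ ⇒ [ M ] ψ)
  box-mono M p = modus-ponens (box-K M _ _) (modus-ponens (truth⇒box M _) p)

  -- Inside [ M ], knowledge of M may be assumed, by self-knowledge.
  box-mono-knowing : ∀ M {φ ψ} → ⊢ (φ ⇒ ((CM knows M) ⇒ ψ)) → ⊢ ([ M ] φ ⇒ [ M ] ψ)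
  box-mono-knowing M p =
    ⇒-apply (⇒-trans (box-mono M p) (box-K M _ _)) (self-knowledge M)

theorem2p36 : (S : Signature) → let open Logic S in
    (M : Signature.Msg S) (φ : Formula) → ⊢ ([ M ] ([ M ] φ) ⇔ [ M ] φ)
theorem2p36 S M φ =
  ⇔-intro (box-mono-knowing M (epistemic-truth M φ)) (truth⇒box M _)
  where
  open Logic S
  open LogicProperties S
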